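{- Let $\Pi$ be a projective plane of order $p^2$, $p\geq 3$ prime, and let $c\in\mathrm{C}(\Pi)^\perp$ have weight $2p^2-2p+2+\epsilon$ with $1\leq\epsilon\leq p-2$, such that every non-zero entry of $c$ is $1$ or $p-1$. Let $K_1$ and $K_{p-1}$ be the sets of points at which $c$ has entry $1$ and $p-1$ respectively. If $\bigl||K_1|-|K_{p-1}|\bigr|=p$, then $\Pi$ contains a Baer subplane $\mathcal{B}$ (a subplane of order $p$) and a line $\ell$ of $\Pi$ meeting $\mathcal{B}$ in $p+1$ points such that $c=v_{\mathcal{B}}-v_\ell$ or $c=v_\ell-v_{\mathcal{B}}$, where $v_{\mathcal{B}}$ and $v_\ell$ are the incidence vectors of the point sets of $\mathcal{B}$ and $\ell$.
   Context: $\mathrm{C}(\Pi)$ is the $\mathbb{F}_p$-span of the incidence vectors of the lines of $\Pi$, viewed as vectors in $\mathbb{F}_p^{p^4+p^2+1}$ indexed by points; $\mathrm{C}(\Pi)^\perp$ is the set of vectors $v$ with $\sum_{P\in\ell}v_P=0$ in $\mathbb{F}_p$ for every line $\ell$. Elements of $\mathbb{F}_p$ are represented by integers in $\{0,\dots,p-1\}$. The weight is the number of non-zero positions. -}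

module Defs where

open import Data.Nat using (ℕ; zero; suc; _+_; _*_; _∸_; _%_; NonZero)
open import Data.Nat.Primality using (Prime)
open import Data.Fin using (Fin; toℕ)
open import Data.Bool using (Bool; true; false; if_then_else_)
import Data.Bool
import Data.Nat
import Data.Fin
open import Data.Product using (Σ; _×_; _,_; ∃-syntax)
open import Data.Sum using (_⊎_)
open import Relation.Binary.PropositionalEquality using (_≡_; _≢_)
open import Relation.Nullary using (¬_)

sumFin : (n : ℕ) → (Fin n → ℕ) → ℕ
sumFin zero    f = 0
sumFin (suc n) f = f Data.Fin.zero + sumFin n (λ i → f (Data.Fin.suc i))

countFin : (n : ℕ) → (Fin n → Bool) → ℕ
countFin n b = sumFin n (λ i → if b i then 1 else 0)

numPts : ℕ → ℕ
numPts q = q * q + q + 1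

record ProjectivePlane (q : ℕ) : Set where
  field
    I : Fin (numPts q) → Fin (numPts q) → Bool
    join : ∀ P Q → P ≢ Q → Σ (Fin (numPts q)) λ ℓ → (I P ℓ ≡ true) × (I Q ℓ ≡ true)
    join-unique : ∀ P Q ℓ m → P ≢ Q → I P ℓ ≡ true → I Q ℓ ≡ true →
                  I P m ≡ true → I Q m ≡ true → ℓ ≡ m
    meet : ∀ ℓ m → ℓ ≢ m → Σ (Fin (numPts q)) λ P → (I P ℓ ≡ true) × (I P m ≡ true)
    meet-unique : ∀ ℓ m P Q → ℓ ≢ m → I P ℓ ≡ true → I P m ≡ true →
                  I Q ℓ ≡ true → I Q m ≡ true → P ≡ Q
    quadrangle : Σ (Fin 4 → Fin (numPts q)) λ R →
                   (∀ i j → i ≢ j → R i ≢ R j) ×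
                   (∀ i j k → i ≢ j → j ≢ k → i ≢ k → ∀ ℓ →
                      ¬ ((I (R i) ℓ ≡ true) × (I (R j) ℓ ≡ true) × (I (R k) ℓ ≡ true)))
    order : ∀ ℓ → countFin (numPts q) (λ P → I P ℓ) ≡ suc q

module _ {q : ℕ} (Π : ProjectivePlane q) where
  open ProjectivePlane Π

  Point Line : Set
  Point = Fin (numPts q)
  Line  = Fin (numPts q)

  pointsOnIn : (Point → Bool) → Line → ℕ
  pointsOnIn S ℓ = countFin (numPts q) (λ P → Data.Bool._∧_ (S P) (I P ℓ))

  IsSubplane : (k : ℕ) → (Point → Bool) → (Line → Bool) → Set
  IsSubplane k S T =
    (∀ P Q → S P ≡ true → S Q ≡ true → P ≢ Q →
       Σ Line λ ℓ → (T ℓ ≡ true) × (I P ℓ ≡ true) × (I Q ℓ ≡ true)) ×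
    (∀ ℓ m → T ℓ ≡ true → T m ≡ true → ℓ ≢ m →
       Σ Point λ P → (S P ≡ true) × (I P ℓ ≡ true) × (I P m ≡ true)) ×
    (Σ (Fin 4 → Point) λ R → (∀ i → S (R i) ≡ true) ×
       (∀ i j → i ≢ j → R i ≢ R j) ×
       (∀ i j k → i ≢ j → j ≢ k → i ≢ k → ∀ ℓ → T ℓ ≡ true →
          ¬ ((I (R i) ℓ ≡ true) × (I (R j) ℓ ≡ true) × (I (R k) ℓ ≡ true)))) ×
    (∀ ℓ → T ℓ ≡ true → pointsOnIn S ℓ ≡ suc k)

  -- vectors over F_p indexed by points
  -- c ∈ C(Π)^⊥ : the entries on every line sum to 0 in F_p
  InDualCode : (p : ℕ) .{{_ : NonZero p}} → (Point → Fin p) → Set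
  InDualCode p c = ∀ ℓ → sumFin (numPts q) (λ P → if I P ℓ then toℕ (c P) else 0) % p ≡ 0

  weight : {p : ℕ} → (Point → Fin p) → ℕ
  weight c = countFin (numPts q) (λ P → Data.Bool.not (isZero (toℕ (c P))))
    where
    isZero : ℕ → Bool
    isZero zero = true
    isZero (suc _) = false

  entryCount : {p : ℕ} → (Point → Fin p) → ℕ → ℕ
  entryCount c a = countFin (numPts q) (λ P → eqℕ (toℕ (c P)) a)
    where
    eqℕ : ℕ → ℕ → Bool
    eqℕ m n = Data.Nat._≡ᵇ_ m n

  indic : Bool → ℕ
  indic b = if b then 1 else 0

  IsDifference : (p : ℕ) .{{_ : NonZero p}} → (Point → Fin p) → (Point → Bool) → (Point → Bool) → Set
  IsDifference p c X Y = ∀ P → toℕ (c P) ≡ (indic (X P) + (p ∸ indic (Y P))) % p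

  lineSet : Line → Point → Bool
  lineSet ℓ P = I P ℓ

{-# OPTIONS --safe #-}
module Submission where

-- Let A and B be the supports of the values 1 and −1, with |A| = |B| + p (the other case is
-- symmetric), and let x, y count the points of A, B on a line, so that p divides x + (p−1)y. The
-- weight bound gives |B| ≤ p² − p. On a line through P ∈ A the number x + (p−1)y is a positive
-- multiple of p, and its sum over the pencil of P is p(|B| + p) + p ≤ p(p² + 1). Hence
-- |B| = p² − p and every line meeting A has (x, y) = (p, 0) or (1, 1). Each Q ∈ B is then on
-- exactly one line missing A, so B lies on a single line ℓ₀, and A ∪ (ℓ₀ ∖ B), with ℓ₀ and the
-- lines having x = p, is the Baer subplane.

open import Defs
open import Data.Nat using (ℕ; zero; suc; _+_; _*_; _∸_; _≤_; z≤n; s≤s; s≤s⁻¹; _≡ᵇ_; _≤?_; ∣_-_∣; NonZero)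
open import Data.Nat.Properties
open import Data.Nat.Divisibility using (_∣_; ∣⇒≤; ∣m+n∣m⇒∣n; m∣m*n; m%n≡0⇒n∣m)
open import Data.Nat.DivMod using (_%_; n%n≡0; [m+n]%n≡m%n; m<n⇒m%n≡m)
open import Data.Nat.Primality using (Prime)
open import Data.Nat.Tactic.RingSolver using (solve-∀)
open import Data.Fin using (Fin; zero; suc; toℕ) renaming (_≟_ to _≟ᶠ_)
open import Data.Fin.Patterns using (0F; 1F; 2F; 3F)
open import Data.Bool using (Bool; true; false; _∧_; _∨_; not; if_then_else_; T)
open import Data.Bool.Properties using (¬-not; not-¬)
open import Data.Product using (Σ; ∃; _×_; _,_; proj₁; proj₂)
open import Data.Sum using (_⊎_; inj₁; inj₂)
open import Relation.Nullary using (¬_; does; yes; no; contradiction)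
open import Relation.Binary.PropositionalEquality using (_≡_; _≢_; refl; sym; trans; cong; cong₂; subst; ≢-sym; module ≡-Reasoning)

-- Truth values as numbers

⟦_⟧ : Bool → ℕ
⟦ b ⟧ = if b then 1 else 0

⟦∧⟧ : ∀ a b → ⟦ a ∧ b ⟧ ≡ ⟦ a ⟧ * ⟦ b ⟧
⟦∧⟧ false b = refl
⟦∧⟧ true  b = sym (*-identityˡ ⟦ b ⟧)

∧-intro : ∀ {a b} → a ≡ true → b ≡ true → a ∧ b ≡ true
∧-intro refl refl = refl

∧-elim : ∀ {a b} → a ∧ b ≡ true → a ≡ true × b ≡ true
∧-elim {true} {true} _ = refl , refl

-- Sums over Fin n

sumFin-cong : ∀ n {f g : Fin n → ℕ} → (∀ i → f i ≡ g i) → sumFin n f ≡ sumFin n g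
sumFin-cong zero    f≗g = refl
sumFin-cong (suc n) f≗g = cong₂ _+_ (f≗g zero) (sumFin-cong n (λ i → f≗g (suc i)))

sumFin-+ : ∀ n (f g : Fin n → ℕ) → sumFin n (λ i → f i + g i) ≡ sumFin n f + sumFin n g
sumFin-+ zero    f g = refl
sumFin-+ (suc n) f g rewrite sumFin-+ n (λ i → f (suc i)) (λ i → g (suc i)) =
  interchange (f zero) (g zero) _ _
  where
  interchange : ∀ a b c d → (a + b) + (c + d) ≡ (a + c) + (b + d)
  interchange = solve-∀

sumFin-*ˡ : ∀ n k (f : Fin n → ℕ) → sumFin n (λ i → k * f i) ≡ k * sumFin n f
sumFin-*ˡ zero    k f = sym (*-zeroʳ k)
sumFin-*ˡ (suc n) k f rewrite sumFin-*ˡ n k (λ i → f (suc i)) = sym (*-distribˡ-+ k (f zero) _)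

sumFin-0 : ∀ n → sumFin n (λ _ → 0) ≡ 0
sumFin-0 zero    = refl
sumFin-0 (suc n) = sumFin-0 n

sumFin-1 : ∀ n → sumFin n (λ _ → 1) ≡ n
sumFin-1 zero    = refl
sumFin-1 (suc n) = cong suc (sumFin-1 n)

sumFin-swap : ∀ m n (f : Fin m → Fin n → ℕ) →
  sumFin m (λ i → sumFin n (f i)) ≡ sumFin n (λ j → sumFin m (λ i → f i j))
sumFin-swap zero    n f = sym (sumFin-0 n)
sumFin-swap (suc m) n f rewrite sumFin-swap m n (λ i → f (suc i)) = sym (sumFin-+ n (f zero) _)

sumFin-mono : ∀ n {f g : Fin n → ℕ} → (∀ i → f i ≤ g i) → sumFin n f ≤ sumFin n g
sumFin-mono zero    f≤g = z≤n
sumFin-mono (suc n) f≤g = +-mono-≤ (f≤g zero) (sumFin-mono n (λ i → f≤g (suc i)))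

-- Monotonicity of the other terms leaves no slack for any single one. Counting over a pencil ends
-- here: a bound on every line, compared with the total, becomes an equality on every line.
sumFin-squeeze : ∀ n {f g : Fin n → ℕ} → (∀ i → f i ≤ g i) → sumFin n g ≤ sumFin n f →
  ∀ i → f i ≡ g i
sumFin-squeeze (suc n) {f} {g} f≤g Σg≤Σf zero =
  ≤-antisym (f≤g zero)
    (+-cancelʳ-≤ _ (g zero) (f zero)
      (≤-trans Σg≤Σf (+-monoʳ-≤ (f zero) (sumFin-mono n (λ i → f≤g (suc i))))))
sumFin-squeeze (suc n) {f} {g} f≤g Σg≤Σf (suc i) =
  sumFin-squeeze n (λ j → f≤g (suc j))
    (+-cancelˡ-≤ (f zero) _ _ (≤-trans (+-monoˡ-≤ _ (f≤g zero)) Σg≤Σf)) i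

δ : ∀ {n} → Fin n → Fin n → ℕ
δ i j = ⟦ does (i ≟ᶠ j) ⟧

sumFin-δ : ∀ n (i : Fin n) (f : Fin n → ℕ) → sumFin n (λ j → δ i j * f j) ≡ f i
sumFin-δ (suc n) zero f rewrite sumFin-0 n = trans (+-identityʳ _) (*-identityˡ (f zero))
sumFin-δ (suc n) (suc i) f = sumFin-δ n i (λ j → f (suc j))

countFin-δ : ∀ n (i : Fin n) → sumFin n (δ i) ≡ 1
countFin-δ n i = trans (sumFin-cong n (λ j → sym (*-identityʳ (δ i j)))) (sumFin-δ n i (λ _ → 1))

-- Cardinalities of subsets of Fin n

countFin-positive : ∀ n {f : Fin n → Bool} i → f i ≡ true → 1 ≤ countFin n f
countFin-positive (suc n) zero    fi rewrite fi = s≤s z≤n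
countFin-positive (suc n) (suc i) fi = ≤-trans (countFin-positive n i fi) (m≤n+m _ _)

countFin-member : ∀ n (f : Fin n → Bool) → 1 ≤ countFin n f → ∃ λ i → f i ≡ true
countFin-member (suc n) f 1≤ with f zero in eq
... | true  = zero , eq
... | false with i , fi ← countFin-member n (λ i → f (suc i)) 1≤ = suc i , fi

countFin-unique : ∀ n {f : Fin n → Bool} i → f i ≡ true → (∀ j → f j ≡ true → i ≡ j) →
  countFin n f ≡ 1
countFin-unique n {f} i fi only = trans (sumFin-cong n pointwise) (countFin-δ n i)
  where
  pointwise : ∀ j → ⟦ f j ⟧ ≡ δ i j
  pointwise j with i ≟ᶠ j
  ... | yes refl = cong ⟦_⟧ fi
  ... | no i≢j   = cong ⟦_⟧ (¬-not (λ fj → i≢j (only j fj)))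

countFin-empty : ∀ n {f : Fin n → Bool} → countFin n f ≡ 0 → ∀ i → f i ≡ false
countFin-empty n eq i = ¬-not (λ fi → n≮0 (subst (1 ≤_) eq (countFin-positive n i fi)))

-- `δ i` + `δ j` lies pointwise below the indicator of `f` and sums to 2.
countFin-pair : ∀ n {f : Fin n → Bool} {i j} → i ≢ j → f i ≡ true → f j ≡ true → 2 ≤ countFin n f
countFin-pair n {f} {i} {j} i≢j fi fj =
  subst (_≤ countFin n f)
    (trans (sumFin-+ n (δ i) (δ j)) (cong₂ _+_ (countFin-δ n i) (countFin-δ n j)))
    (sumFin-mono n pointwise)
  where
  pointwise : ∀ k → δ i k + δ j k ≤ ⟦ f k ⟧
  pointwise k with i ≟ᶠ k | j ≟ᶠ k
  ... | yes refl | yes refl = contradiction refl i≢j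
  ... | yes refl | no _     = ≤-reflexive (sym (cong ⟦_⟧ fi))
  ... | no _     | yes refl = ≤-reflexive (sym (cong ⟦_⟧ fj))
  ... | no _     | no _     = z≤n

_∖_ : ∀ {n} → (Fin n → Bool) → Fin n → Fin n → Bool
(f ∖ i) j = f j ∧ not (does (i ≟ᶠ j))

∖-elim : ∀ {n} {f : Fin n → Bool} {i j} → (f ∖ i) j ≡ true → f j ≡ true × i ≢ j
∖-elim {f = f} {i} {j} eq with f j | i ≟ᶠ j
... | true | no i≢j = refl , i≢j

countFin-∖ : ∀ n (f : Fin n → Bool) i → countFin n f ≤ suc (countFin n (f ∖ i))
countFin-∖ n f i =
  subst (countFin n f ≤_)
    (trans (sumFin-+ n (δ i) _) (cong (_+ countFin n (f ∖ i)) (countFin-δ n i)))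
    (sumFin-mono n pointwise)
  where
  pointwise : ∀ j → ⟦ f j ⟧ ≤ δ i j + ⟦ (f ∖ i) j ⟧
  pointwise j with f j | does (i ≟ᶠ j)
  ... | true  | true  = ≤-refl
  ... | true  | false = ≤-refl
  ... | false | _     = z≤n

countFin-other : ∀ n (f : Fin n → Bool) i → 2 ≤ countFin n f → ∃ λ j → f j ≡ true × i ≢ j
countFin-other n f i 2≤ with j , fj ← countFin-member n (f ∖ i) (s≤s⁻¹ (≤-trans 2≤ (countFin-∖ n f i))) =
  j , ∖-elim {f = f} fj

countFin-others : ∀ n (f : Fin n → Bool) i → 3 ≤ countFin n f →
  ∃ λ j → ∃ λ k → (f j ≡ true × i ≢ j) × (f k ≡ true × i ≢ k) × j ≢ k
countFin-others n f i 3≤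
  with 2≤ ← s≤s⁻¹ (≤-trans 3≤ (countFin-∖ n f i))
  with j , fj ← countFin-member n (f ∖ i) (≤-trans (n≤1+n 1) 2≤)
  with k , fk , j≢k ← countFin-other n (f ∖ i) j 2≤ =
  j , k , ∖-elim {f = f} fj , ∖-elim {f = f} fk , j≢k

countFin-≤1 : ∀ n (f : Fin n → Bool) → (∀ i j → f i ≡ true → f j ≡ true → i ≡ j) → countFin n f ≤ 1
countFin-≤1 n f subsingleton with countFin n f ≤? 1
... | yes ≤1 = ≤1
... | no ≰1
  with i , fi ← countFin-member n f (≤-trans (n≤1+n 1) (≰⇒> ≰1))
  with j , fj , i≢j ← countFin-other n f i (≰⇒> ≰1) = contradiction (subsingleton i j fi fj) i≢j

-- Pencils of lines

module Pencil {q : ℕ} .{{_ : NonZero q}} (Π : ProjectivePlane q) where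
  open ProjectivePlane Π

  N : ℕ
  N = numPts q

  degree : Point Π → ℕ
  degree P = countFin N (I P)

  -- Distinct points have one joining line; for `P` = `Q` the sum is the degree. The extra `δ P Q`
  -- puts both cases into one equation without subtraction.
  join-count : ∀ P Q → sumFin N (λ ℓ → ⟦ I P ℓ ⟧ * ⟦ I Q ℓ ⟧) + δ P Q ≡ 1 + δ P Q * degree P
  join-count P Q with P ≟ᶠ Q
  ... | yes refl = begin
    sumFin N (λ ℓ → ⟦ I P ℓ ⟧ * ⟦ I P ℓ ⟧) + 1 ≡⟨ +-comm _ 1 ⟩
    1 + sumFin N (λ ℓ → ⟦ I P ℓ ⟧ * ⟦ I P ℓ ⟧) ≡⟨ cong suc (sumFin-cong N (λ ℓ → idem (I P ℓ))) ⟩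
    1 + degree P                                ≡⟨ cong suc (sym (*-identityˡ (degree P))) ⟩
    1 + 1 * degree P                            ∎
    where
    open ≡-Reasoning
    idem : ∀ b → ⟦ b ⟧ * ⟦ b ⟧ ≡ ⟦ b ⟧
    idem false = refl
    idem true  = refl
  ... | no P≢Q with k , Pk , Qk ← join P Q P≢Q =
    trans (+-identityʳ _)
      (trans (sumFin-cong N (λ ℓ → sym (⟦∧⟧ (I P ℓ) (I Q ℓ))))
        (countFin-unique N k (∧-intro Pk Qk)
          (λ ℓ on → join-unique P Q k ℓ P≢Q Pk Qk (proj₁ (∧-elim on)) (proj₂ (∧-elim on)))))

  -- Double counting of the pairs (Q, ℓ) with Q in `X` and ℓ through both `P` and Q. The degree of
  -- `P` stays symbolic, since this identity is what determines it.
  pencil-degree : ∀ P X →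
    sumFin N (λ ℓ → ⟦ I P ℓ ⟧ * pointsOnIn Π X ℓ) + ⟦ X P ⟧ ≡ countFin N X + ⟦ X P ⟧ * degree P
  pencil-degree P X = begin
    sumFin N (λ ℓ → ⟦ I P ℓ ⟧ * pointsOnIn Π X ℓ) + ⟦ X P ⟧
      ≡⟨ cong₂ _+_ double-count (sym (sumFin-δ N P (λ Q → ⟦ X Q ⟧))) ⟩
    sumFin N (λ Q → ⟦ X Q ⟧ * μ Q) + sumFin N (λ Q → δ P Q * ⟦ X Q ⟧)
      ≡⟨ sym (sumFin-+ N _ _) ⟩
    sumFin N (λ Q → ⟦ X Q ⟧ * μ Q + δ P Q * ⟦ X Q ⟧)
      ≡⟨ sumFin-cong N pointwise ⟩
    sumFin N (λ Q → ⟦ X Q ⟧ + δ P Q * (⟦ X Q ⟧ * degree P))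
      ≡⟨ sumFin-+ N _ _ ⟩
    countFin N X + sumFin N (λ Q → δ P Q * (⟦ X Q ⟧ * degree P))
      ≡⟨ cong (countFin N X +_) (sumFin-δ N P (λ Q → ⟦ X Q ⟧ * degree P)) ⟩
    countFin N X + ⟦ X P ⟧ * degree P ∎
    where
    open ≡-Reasoning
    μ : Point Π → ℕ
    μ Q = sumFin N (λ ℓ → ⟦ I P ℓ ⟧ * ⟦ I Q ℓ ⟧)

    rearrange : ∀ u a b → u * ⟦ a ∧ b ⟧ ≡ ⟦ a ⟧ * (u * ⟦ b ⟧)
    rearrange u a b = trans (cong (u *_) (⟦∧⟧ a b)) (assoc-comm u ⟦ a ⟧ ⟦ b ⟧)
      where
      assoc-comm : ∀ u v w → u * (v * w) ≡ v * (u * w)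
      assoc-comm = solve-∀

    double-count : sumFin N (λ ℓ → ⟦ I P ℓ ⟧ * pointsOnIn Π X ℓ) ≡ sumFin N (λ Q → ⟦ X Q ⟧ * μ Q)
    double-count = begin
      sumFin N (λ ℓ → ⟦ I P ℓ ⟧ * pointsOnIn Π X ℓ)
        ≡⟨ sumFin-cong N (λ ℓ → sym (sumFin-*ˡ N ⟦ I P ℓ ⟧ _)) ⟩
      sumFin N (λ ℓ → sumFin N (λ Q → ⟦ I P ℓ ⟧ * ⟦ X Q ∧ I Q ℓ ⟧))
        ≡⟨ sumFin-swap N N _ ⟩
      sumFin N (λ Q → sumFin N (λ ℓ → ⟦ I P ℓ ⟧ * ⟦ X Q ∧ I Q ℓ ⟧))
        ≡⟨ sumFin-cong N (λ Q → trans
             (sumFin-cong N (λ ℓ → rearrange ⟦ I P ℓ ⟧ (X Q) (I Q ℓ)))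
             (sumFin-*ˡ N ⟦ X Q ⟧ _)) ⟩
      sumFin N (λ Q → ⟦ X Q ⟧ * μ Q) ∎

    pointwise : ∀ Q → ⟦ X Q ⟧ * μ Q + δ P Q * ⟦ X Q ⟧ ≡ ⟦ X Q ⟧ + δ P Q * (⟦ X Q ⟧ * degree P)
    pointwise Q = begin
      ⟦ X Q ⟧ * μ Q + δ P Q * ⟦ X Q ⟧               ≡⟨ factor ⟦ X Q ⟧ (μ Q) (δ P Q) ⟩
      ⟦ X Q ⟧ * (μ Q + δ P Q)                       ≡⟨ cong (⟦ X Q ⟧ *_) (join-count P Q) ⟩
      ⟦ X Q ⟧ * (1 + δ P Q * degree P)              ≡⟨ expand ⟦ X Q ⟧ (δ P Q) (degree P) ⟩
      ⟦ X Q ⟧ + δ P Q * (⟦ X Q ⟧ * degree P)        ∎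
      where
      factor : ∀ x m d → x * m + d * x ≡ x * (m + d)
      factor = solve-∀
      expand : ∀ x d r → x * (1 + d * r) ≡ x + d * (x * r)
      expand = solve-∀

  -- With `X` the set of all points and d the degree, `pencil-degree` reads (q + 1)d + 1 = q² + q +
  -- 1 + d. Hence qd = q(q + 1), and q cancels.
  lines-through : ∀ P → degree P ≡ suc q
  lines-through P = *-cancelˡ-≡ (degree P) (suc q) q (+-cancelʳ-≡ (degree P + 1) _ _ count-points)
    where
    open ≡-Reasoning
    regroup : ∀ q d → q * d + (d + 1) ≡ suc q * d + 1
    regroup = solve-∀
    regroup′ : ∀ q d → q * q + q + 1 + 1 * d ≡ q * suc q + (d + 1)
    regroup′ = solve-∀
    count-points : q * degree P + (degree P + 1) ≡ q * suc q + (degree P + 1)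
    count-points = begin
      q * degree P + (degree P + 1) ≡⟨ regroup q (degree P) ⟩
      suc q * degree P + 1
        ≡⟨ cong (_+ 1) (sym (sumFin-*ˡ N (suc q) _)) ⟩
      sumFin N (λ ℓ → suc q * ⟦ I P ℓ ⟧) + 1
        ≡⟨ cong (_+ 1) (sumFin-cong N (λ ℓ →
             trans (*-comm (suc q) ⟦ I P ℓ ⟧) (cong (⟦ I P ℓ ⟧ *_) (sym (order ℓ))))) ⟩
      sumFin N (λ ℓ → ⟦ I P ℓ ⟧ * pointsOnIn Π (λ _ → true) ℓ) + 1
        ≡⟨ pencil-degree P (λ _ → true) ⟩
      sumFin N (λ _ → 1) + 1 * degree P
        ≡⟨ cong (_+ 1 * degree P) (sumFin-1 N) ⟩
      q * q + q + 1 + 1 * degree P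
        ≡⟨ regroup′ q (degree P) ⟩
      q * suc q + (degree P + 1) ∎

  pencil-sum : ∀ P X →
    sumFin N (λ ℓ → ⟦ I P ℓ ⟧ * pointsOnIn Π X ℓ) ≡ countFin N X + ⟦ X P ⟧ * q
  pencil-sum P X = +-cancelʳ-≡ ⟦ X P ⟧ _ _ (begin
    sumFin N (λ ℓ → ⟦ I P ℓ ⟧ * pointsOnIn Π X ℓ) + ⟦ X P ⟧ ≡⟨ pencil-degree P X ⟩
    countFin N X + ⟦ X P ⟧ * degree P                       ≡⟨ cong (λ d → countFin N X + ⟦ X P ⟧ * d) (lines-through P) ⟩
    countFin N X + ⟦ X P ⟧ * suc q                          ≡⟨ regroup (countFin N X) ⟦ X P ⟧ q ⟩
    countFin N X + ⟦ X P ⟧ * q + ⟦ X P ⟧                    ∎)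
    where
    open ≡-Reasoning
    regroup : ∀ n x q → n + x * suc q ≡ n + x * q + x
    regroup = solve-∀

  pencil-sum-∉ : ∀ P X → X P ≡ false →
    sumFin N (λ ℓ → ⟦ I P ℓ ⟧ * pointsOnIn Π X ℓ) ≡ countFin N X
  pencil-sum-∉ P X P∉X = trans (pencil-sum P X)
    (trans (cong (λ b → countFin N X + ⟦ b ⟧ * q) P∉X) (+-identityʳ _))

  pencil-sum-∈ : ∀ P X → X P ≡ true →
    sumFin N (λ ℓ → ⟦ I P ℓ ⟧ * pointsOnIn Π X ℓ) ≡ countFin N X + q
  pencil-sum-∈ P X P∈X = trans (pencil-sum P X)
    (cong (countFin N X +_) (trans (cong (λ b → ⟦ b ⟧ * q) P∈X) (*-identityˡ q)))

  misses : ∀ {X ℓ P} → pointsOnIn Π X ℓ ≡ 0 → X P ≡ true → ¬ I P ℓ ≡ true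
  misses {P = P} none XP Pℓ = not-¬ (countFin-empty N none P) (∧-intro XP Pℓ)

  meet-count : ∀ {ℓ m} → ℓ ≢ m → pointsOnIn Π (lineSet Π ℓ) m ≡ 1
  meet-count {ℓ} {m} ℓ≢m with R , Rℓ , Rm ← meet ℓ m ℓ≢m =
    countFin-unique N R (∧-intro Rℓ Rm)
      (λ Q on → meet-unique ℓ m R Q ℓ≢m Rℓ Rm (proj₁ (∧-elim on)) (proj₂ (∧-elim on)))

  -- General position is with respect to all lines of the plane, which is stronger than the
  -- condition for the lines of a subplane.
  Quadrangle : (Point Π → Bool) → Set
  Quadrangle S = Σ (Fin 4 → Point Π) λ R → (∀ i → S (R i) ≡ true) ×
    (∀ i j → i ≢ j → R i ≢ R j) ×
    (∀ i j k → i ≢ j → j ≢ k → i ≢ k → ∀ ℓ →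
       ¬ ((I (R i) ℓ ≡ true) × (I (R j) ℓ ≡ true) × (I (R k) ℓ ≡ true)))

  -- Two points on each line, all different from the intersection point of the two lines.
  quadrangle-from-lines : ∀ S {ℓ m} → ℓ ≢ m → 3 ≤ pointsOnIn Π S ℓ → 3 ≤ pointsOnIn Π S m → Quadrangle S
  quadrangle-from-lines S {ℓ} {m} ℓ≢m 3≤ℓ 3≤m
    with O , Oℓ , Om ← meet ℓ m ℓ≢m
    with A , B , (SA , O≢A) , (SB , O≢B) , A≢B ← countFin-others N _ O 3≤ℓ
    with C , D , (SC , O≢C) , (SD , O≢D) , C≢D ← countFin-others N _ O 3≤m =
    R , inS , distinct , general
    where
    Aℓ = proj₂ (∧-elim SA)
    Bℓ = proj₂ (∧-elim SB)
    Cm = proj₂ (∧-elim SC)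
    Dm = proj₂ (∧-elim SD)

    R : Fin 4 → Point Π
    R 0F = A
    R 1F = B
    R 2F = C
    R 3F = D

    inS : ∀ i → S (R i) ≡ true
    inS 0F = proj₁ (∧-elim SA)
    inS 1F = proj₁ (∧-elim SB)
    inS 2F = proj₁ (∧-elim SC)
    inS 3F = proj₁ (∧-elim SD)

    separate : ∀ {X Y} → I X ℓ ≡ true → I Y m ≡ true → O ≢ X → X ≢ Y
    separate Xℓ Ym O≢X refl = O≢X (meet-unique ℓ m _ _ ℓ≢m Oℓ Om Xℓ Ym)

    distinct : ∀ i j → i ≢ j → R i ≢ R j
    distinct 0F 1F _ = A≢B
    distinct 0F 2F _ = separate Aℓ Cm O≢A
    distinct 0F 3F _ = separate Aℓ Dm O≢A
    distinct 1F 0F _ = ≢-sym A≢B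
    distinct 1F 2F _ = separate Bℓ Cm O≢B
    distinct 1F 3F _ = separate Bℓ Dm O≢B
    distinct 2F 0F _ = ≢-sym (separate Aℓ Cm O≢A)
    distinct 2F 1F _ = ≢-sym (separate Bℓ Cm O≢B)
    distinct 2F 3F _ = C≢D
    distinct 3F 0F _ = ≢-sym (separate Aℓ Dm O≢A)
    distinct 3F 1F _ = ≢-sym (separate Bℓ Dm O≢B)
    distinct 3F 2F _ = ≢-sym C≢D
    distinct 0F 0F i≢i = contradiction refl i≢i
    distinct 1F 1F i≢i = contradiction refl i≢i
    distinct 2F 2F i≢i = contradiction refl i≢i
    distinct 3F 3F i≢i = contradiction refl i≢i

    -- A line through A and B is ℓ, so a third point on it that also lies on m would be O. `not-XCD`
    -- is the same with ℓ and m exchanged.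
    not-ABY : ∀ {Y} → I Y m ≡ true → O ≢ Y → ∀ k → I A k ≡ true → I B k ≡ true → ¬ I Y k ≡ true
    not-ABY Ym O≢Y k Ak Bk Yk with refl ← join-unique A B k ℓ A≢B Ak Bk Aℓ Bℓ =
      O≢Y (meet-unique ℓ m _ _ ℓ≢m Oℓ Om Yk Ym)

    not-XCD : ∀ {X} → I X ℓ ≡ true → O ≢ X → ∀ k → I X k ≡ true → I C k ≡ true → ¬ I D k ≡ true
    not-XCD Xℓ O≢X k Xk Ck Dk with refl ← join-unique C D k m C≢D Ck Dk Cm Dm =
      O≢X (meet-unique ℓ m _ _ ℓ≢m Oℓ Om Xℓ Xk)

    general : ∀ i j k → i ≢ j → j ≢ k → i ≢ k → ∀ n →
      ¬ ((I (R i) n ≡ true) × (I (R j) n ≡ true) × (I (R k) n ≡ true))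
    general 0F 0F _  i≢j _ _ = contradiction refl i≢j
    general 1F 1F _  i≢j _ _ = contradiction refl i≢j
    general 2F 2F _  i≢j _ _ = contradiction refl i≢j
    general 3F 3F _  i≢j _ _ = contradiction refl i≢j
    general _  0F 0F _ j≢k _ = contradiction refl j≢k
    general _  1F 1F _ j≢k _ = contradiction refl j≢k
    general _  2F 2F _ j≢k _ = contradiction refl j≢k
    general _  3F 3F _ j≢k _ = contradiction refl j≢k
    general 0F _  0F _ _ i≢k = contradiction refl i≢k
    general 1F _  1F _ _ i≢k = contradiction refl i≢k
    general 2F _  2F _ _ i≢k = contradiction refl i≢k
    general 3F _  3F _ _ i≢k = contradiction refl i≢k
    general 0F 1F 2F _ _ _ n (a , b , c) = not-ABY Cm O≢C n a b c
    general 0F 1F 3F _ _ _ n (a , b , d) = not-ABY Dm O≢D n a b d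
    general 0F 2F 1F _ _ _ n (a , c , b) = not-ABY Cm O≢C n a b c
    general 0F 2F 3F _ _ _ n (a , c , d) = not-XCD Aℓ O≢A n a c d
    general 0F 3F 1F _ _ _ n (a , d , b) = not-ABY Dm O≢D n a b d
    general 0F 3F 2F _ _ _ n (a , d , c) = not-XCD Aℓ O≢A n a c d
    general 1F 0F 2F _ _ _ n (b , a , c) = not-ABY Cm O≢C n a b c
    general 1F 0F 3F _ _ _ n (b , a , d) = not-ABY Dm O≢D n a b d
    general 1F 2F 0F _ _ _ n (b , c , a) = not-ABY Cm O≢C n a b c
    general 1F 2F 3F _ _ _ n (b , c , d) = not-XCD Bℓ O≢B n b c d
    general 1F 3F 0F _ _ _ n (b , d , a) = not-ABY Dm O≢D n a b d
    general 1F 3F 2F _ _ _ n (b , d , c) = not-XCD Bℓ O≢B n b c d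
    general 2F 0F 1F _ _ _ n (c , a , b) = not-ABY Cm O≢C n a b c
    general 2F 0F 3F _ _ _ n (c , a , d) = not-XCD Aℓ O≢A n a c d
    general 2F 1F 0F _ _ _ n (c , b , a) = not-ABY Cm O≢C n a b c
    general 2F 1F 3F _ _ _ n (c , b , d) = not-XCD Bℓ O≢B n b c d
    general 2F 3F 0F _ _ _ n (c , d , a) = not-XCD Aℓ O≢A n a c d
    general 2F 3F 1F _ _ _ n (c , d , b) = not-XCD Bℓ O≢B n b c d
    general 3F 0F 1F _ _ _ n (d , a , b) = not-ABY Dm O≢D n a b d
    general 3F 0F 2F _ _ _ n (d , a , c) = not-XCD Aℓ O≢A n a c d
    general 3F 1F 0F _ _ _ n (d , b , a) = not-ABY Dm O≢D n a b d
    general 3F 1F 2F _ _ _ n (d , b , c) = not-XCD Bℓ O≢B n b c d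
    general 3F 2F 0F _ _ _ n (d , c , a) = not-XCD Aℓ O≢A n a c d
    general 3F 2F 1F _ _ _ n (d , c , b) = not-XCD Bℓ O≢B n b c d

-- Two-valued codewords as pairs of point sets

-- Here p = suc r; the order q is a variable so that numPts q does not unfold.
module TwoSets (r : ℕ) (2≤r : 2 ≤ r) {q : ℕ} .{{_ : NonZero q}} (q≡p² : q ≡ suc r * suc r)
  (Π : ProjectivePlane q)
  (A B : Point Π → Bool) (A∩B=∅ : ∀ P → A P ≡ true → B P ≡ false)
  (divides : ∀ ℓ → suc r ∣ pointsOnIn Π A ℓ + r * pointsOnIn Π B ℓ)
  (∣A∣≡∣B∣+p : countFin (numPts q) A ≡ countFin (numPts q) B + suc r)
  (∣B∣+p≤q : countFin (numPts q) B + suc r ≤ q)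
  where
  open ProjectivePlane Π
  open Pencil Π

  p ∣A∣ ∣B∣ : ℕ
  p   = suc r
  ∣A∣ = countFin N A
  ∣B∣ = countFin N B

  x y : Line Π → ℕ
  x = pointsOnIn Π A
  y = pointsOnIn Π B

  -- Lines through a point of A

  somePoint-A : ∃ λ P → A P ≡ true
  somePoint-A = countFin-member N A (subst (1 ≤_) (sym ∣A∣≡∣B∣+p) (≤-trans (s≤s z≤n) (m≤n+m p ∣B∣)))

  A-point⇒1≤x : ∀ {P ℓ} → A P ≡ true → I P ℓ ≡ true → 1 ≤ x ℓ
  A-point⇒1≤x AP Pℓ = countFin-positive N _ (∧-intro AP Pℓ)

  module AtPointOfA {P : Point Π} (AP : A P ≡ true) where
    load : Line Π → ℕ
    load ℓ = ⟦ I P ℓ ⟧ * (x ℓ + r * y ℓ)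

    -- On a line through `P` the point `P` itself makes `x` positive, and a positive multiple of p
    -- is at least p.
    p≤load : ∀ ℓ → ⟦ I P ℓ ⟧ * p ≤ load ℓ
    p≤load ℓ with I P ℓ in Pℓ
    ... | false = z≤n
    ... | true  = *-monoʳ-≤ 1 (nonzero-multiple (divides ℓ) (≤-trans (A-point⇒1≤x AP Pℓ) (m≤m+n _ _)))
      where
      nonzero-multiple : ∀ {k} → p ∣ k → 1 ≤ k → p ≤ k
      nonzero-multiple {suc k} p∣k _ = ∣⇒≤ p∣k

    -- Over the pencil of `P`, the set A contributes |A| + q, as `P` is on all q + 1 lines, and B
    -- contributes |B| with factor r.
    sum-load : sumFin N load ≡ p * (∣B∣ + p) + p
    sum-load = begin
      sumFin N load
        ≡⟨ sumFin-cong N (λ ℓ → distribute ⟦ I P ℓ ⟧ (x ℓ) (y ℓ) r) ⟩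
      sumFin N (λ ℓ → ⟦ I P ℓ ⟧ * x ℓ + r * (⟦ I P ℓ ⟧ * y ℓ))
        ≡⟨ trans (sumFin-+ N _ _) (cong (sumFin N (λ ℓ → ⟦ I P ℓ ⟧ * x ℓ) +_) (sumFin-*ˡ N r _)) ⟩
      sumFin N (λ ℓ → ⟦ I P ℓ ⟧ * x ℓ) + r * sumFin N (λ ℓ → ⟦ I P ℓ ⟧ * y ℓ)
        ≡⟨ cong₂ (λ u v → u + r * v) (pencil-sum-∈ P A AP) (pencil-sum-∉ P B (A∩B=∅ P AP)) ⟩
      (∣A∣ + q) + r * ∣B∣
        ≡⟨ cong₂ (λ a q → a + q + r * ∣B∣) ∣A∣≡∣B∣+p q≡p² ⟩
      (∣B∣ + p + p * p) + r * ∣B∣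
        ≡⟨ regroup ∣B∣ r ⟩
      p * (∣B∣ + p) + p ∎
      where
      open ≡-Reasoning
      distribute : ∀ u v w r → u * (v + r * w) ≡ u * v + r * (u * w)
      distribute = solve-∀
      regroup : ∀ b r → (b + suc r + suc r * suc r) + r * b ≡ suc r * (b + suc r) + suc r
      regroup = solve-∀

    sum-p : sumFin N (λ ℓ → ⟦ I P ℓ ⟧ * p) ≡ p * q + p
    sum-p = begin
      sumFin N (λ ℓ → ⟦ I P ℓ ⟧ * p) ≡⟨ sumFin-cong N (λ ℓ → *-comm ⟦ I P ℓ ⟧ p) ⟩
      sumFin N (λ ℓ → p * ⟦ I P ℓ ⟧) ≡⟨ sumFin-*ˡ N p _ ⟩
      p * degree P                   ≡⟨ cong (p *_) (lines-through P) ⟩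
      p * suc q                      ≡⟨ trans (*-suc p q) (+-comm p _) ⟩
      p * q + p                      ∎
      where open ≡-Reasoning

    -- The hypothesis |B| + p ≤ q bounds the total load by p(q + 1), which is what the termwise
    -- bounds already add up to.
    load≡p : ∀ {ℓ} → I P ℓ ≡ true → x ℓ + r * y ℓ ≡ p
    load≡p {ℓ} Pℓ = begin
      x ℓ + r * y ℓ ≡⟨ sym (*-identityˡ _) ⟩
      1 * (x ℓ + r * y ℓ) ≡⟨ cong (λ b → ⟦ b ⟧ * (x ℓ + r * y ℓ)) (sym Pℓ) ⟩
      load ℓ ≡⟨ sym (sumFin-squeeze N p≤load total ℓ) ⟩
      ⟦ I P ℓ ⟧ * p ≡⟨ cong (λ b → ⟦ b ⟧ * p) Pℓ ⟩
      1 * p ≡⟨ *-identityˡ p ⟩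
      p ∎
      where
      open ≡-Reasoning
      total : sumFin N load ≤ sumFin N (λ ℓ → ⟦ I P ℓ ⟧ * p)
      total = ≤-trans (≤-reflexive sum-load)
        (≤-trans (+-monoˡ-≤ p (*-monoʳ-≤ p ∣B∣+p≤q)) (≤-reflexive (sym sum-p)))

    -- The same two totals compared in the other direction: q + 1 lines of load at least p each.
    q≤∣B∣+p : q ≤ ∣B∣ + p
    q≤∣B∣+p = *-cancelˡ-≤ p (+-cancelʳ-≤ p _ _
      (≤-trans (≤-reflexive (sym sum-p)) (≤-trans (sumFin-mono N p≤load) (≤-reflexive sum-load))))

  ∣B∣+p≡q : ∣B∣ + p ≡ q
  ∣B∣+p≡q = ≤-antisym ∣B∣+p≤q (AtPointOfA.q≤∣B∣+p (proj₂ somePoint-A))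

  -- Abstract because with-abstraction would otherwise normalise this proof at every use.
  abstract
    secant-or-tangent : ∀ {ℓ} → 1 ≤ x ℓ → (x ℓ ≡ p × y ℓ ≡ 0) ⊎ (x ℓ ≡ 1 × y ℓ ≡ 1)
    secant-or-tangent {ℓ} 1≤x
      with P , on ← countFin-member N _ 1≤x
      with AP , Pℓ ← ∧-elim on = split (x ℓ) (y ℓ) 1≤x (AtPointOfA.load≡p AP Pℓ)
      where
      split : ∀ u v → 1 ≤ u → u + r * v ≡ p → (u ≡ p × v ≡ 0) ⊎ (u ≡ 1 × v ≡ 1)
      split u 0 _ eq = inj₁ (trans (sym (trans (cong (u +_) (*-zeroʳ r)) (+-identityʳ u))) eq , refl)
      split u 1 _ eq = inj₂ (+-cancelʳ-≡ r u 1 (trans (cong (u +_) (sym (*-identityʳ r))) eq) , refl)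
      -- Two points of B already give at least 1 + 2r, which exceeds p = 1 + r.
      split u (suc (suc v)) 1≤u eq = contradiction (≤-reflexive eq) (<⇒≱ (begin-strict
        1 + r         <⟨ m<m+n (1 + r) (≤-trans (s≤s z≤n) 2≤r) ⟩
        1 + r + r     ≡⟨ double r ⟩
        1 + r * 2     ≤⟨ +-mono-≤ 1≤u (*-monoʳ-≤ r {2} (s≤s (s≤s z≤n))) ⟩
        u + r * suc (suc v) ∎))
        where
        open ≤-Reasoning
        double : ∀ r → 1 + r + r ≡ 1 + r * 2
        double = solve-∀

  line-type : ∀ ℓ → x ℓ ≡ 0 ⊎ (x ℓ ≡ p × y ℓ ≡ 0) ⊎ (x ℓ ≡ 1 × y ℓ ≡ 1)
  line-type ℓ = zero-or-positive (x ℓ) refl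
    where
    zero-or-positive : ∀ n → x ℓ ≡ n → x ℓ ≡ 0 ⊎ (x ℓ ≡ p × y ℓ ≡ 0) ⊎ (x ℓ ≡ 1 × y ℓ ≡ 1)
    zero-or-positive zero    x≡0 = inj₁ x≡0
    zero-or-positive (suc n) x≡  = inj₂ (secant-or-tangent (subst (1 ≤_) (sym x≡) (s≤s z≤n)))

  -- Lines through a point of B

  somePoint-B : ∃ λ Q → B Q ≡ true
  somePoint-B = countFin-member N B (+-cancelʳ-≤ p 1 ∣B∣ (begin
    -- B is nonempty because |B| + p = p² ≥ 2p ≥ p + 1.
    1 + p   ≤⟨ +-monoˡ-≤ p (s≤s z≤n) ⟩
    p + p   ≡⟨ double r ⟩
    2 * p   ≤⟨ *-monoˡ-≤ p (≤-trans 2≤r (n≤1+n r)) ⟩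
    p * p   ≡⟨ sym q≡p² ⟩
    q       ≡⟨ sym ∣B∣+p≡q ⟩
    ∣B∣ + p ∎))
    where
    open ≤-Reasoning
    double : ∀ r → suc r + suc r ≡ 2 * suc r
    double = solve-∀

  -- The p² points of A lie on p² different lines through Q, so exactly one of the p² + 1 lines through Q misses A.
  module AtPointOfB {Q : Point Π} (BQ : B Q ≡ true) where
    -- A line with p points of A has no point of B, but `Q` lies on this one.
    x≤1 : ∀ {ℓ} → I Q ℓ ≡ true → x ℓ ≤ 1
    x≤1 {ℓ} Qℓ with line-type ℓ
    ... | inj₁ x≡0                = ≤-trans (≤-reflexive x≡0) z≤n
    ... | inj₂ (inj₁ (_ , y≡0))   = contradiction Qℓ (misses y≡0 BQ)
    ... | inj₂ (inj₂ (x≡1 , _))   = ≤-reflexive x≡1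

    sum-x : sumFin N (λ ℓ → ⟦ I Q ℓ ⟧ * x ℓ) ≡ q
    sum-x = trans (pencil-sum-∉ Q A (¬-not (λ AQ → contradiction BQ (not-¬ (A∩B=∅ Q AQ)))))
      (trans ∣A∣≡∣B∣+p ∣B∣+p≡q)

    external : ∃ λ ℓ → I Q ℓ ≡ true × x ℓ ≡ 0
    external = extract (countFin-member N _ some)
      where
      extract : (∃ λ ℓ → I Q ℓ ∧ (x ℓ ≡ᵇ 0) ≡ true) → ∃ λ ℓ → I Q ℓ ≡ true × x ℓ ≡ 0
      extract (ℓ , on) with Qℓ , x≡ᵇ0 ← ∧-elim on = ℓ , Qℓ , ≡ᵇ⇒≡ (x ℓ) 0 (subst T (sym x≡ᵇ0) _)
      -- Each line through `Q` is either external or accounts for at least one of the q points of A.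
      pointwise : ∀ ℓ → ⟦ I Q ℓ ⟧ ≤ ⟦ I Q ℓ ∧ (x ℓ ≡ᵇ 0) ⟧ + ⟦ I Q ℓ ⟧ * x ℓ
      pointwise ℓ with I Q ℓ | x ℓ
      ... | false | _     = z≤n
      ... | true  | zero  = ≤-refl
      ... | true  | suc _ = s≤s z≤n
      some : 1 ≤ countFin N (λ ℓ → I Q ℓ ∧ (x ℓ ≡ᵇ 0))
      some = +-cancelʳ-≤ q 1 _ (begin
        suc q  ≡⟨ sym (lines-through Q) ⟩
        degree Q     ≤⟨ sumFin-mono N pointwise ⟩
        sumFin N (λ ℓ → ⟦ I Q ℓ ∧ (x ℓ ≡ᵇ 0) ⟧ + ⟦ I Q ℓ ⟧ * x ℓ) ≡⟨ sumFin-+ N _ _ ⟩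
        countFin N (λ ℓ → I Q ℓ ∧ (x ℓ ≡ᵇ 0)) + sumFin N (λ ℓ → ⟦ I Q ℓ ⟧ * x ℓ)
          ≡⟨ cong (countFin N (λ ℓ → I Q ℓ ∧ (x ℓ ≡ᵇ 0)) +_) sum-x ⟩
        countFin N (λ ℓ → I Q ℓ ∧ (x ℓ ≡ᵇ 0)) + q ∎)
        where open ≤-Reasoning

    -- Two external lines, together with the q lines needed for the points of A, would make q + 2
    -- lines through `Q`.
    external-unique : ∀ {ℓ m} → I Q ℓ ≡ true → x ℓ ≡ 0 → I Q m ≡ true → x m ≡ 0 → ℓ ≡ m
    external-unique {ℓ} {m} Qℓ xℓ Qm xm with ℓ ≟ᶠ m
    ... | yes ℓ≡m = ℓ≡m
    ... | no  ℓ≢m = contradiction overfull (<⇒≱ (n<1+n (suc q)))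
      where
      pointwise : ∀ k → δ ℓ k + δ m k + ⟦ I Q k ⟧ * x k ≤ ⟦ I Q k ⟧
      pointwise k with ℓ ≟ᶠ k | m ≟ᶠ k
      ... | yes refl | yes refl = contradiction refl ℓ≢m
      ... | yes refl | no _     rewrite Qℓ | xℓ = ≤-refl
      ... | no _     | yes refl rewrite Qm | xm = ≤-refl
      ... | no _     | no _     with I Q k in Qk
      ...   | false = z≤n
      ...   | true  = subst (_≤ 1) (sym (*-identityˡ (x k))) (x≤1 Qk)
      overfull : suc (suc q) ≤ suc q
      overfull = begin
        1 + 1 + q
          ≡⟨ sym (cong₂ _+_ (cong₂ _+_ (countFin-δ N ℓ) (countFin-δ N m)) sum-x) ⟩
        sumFin N (δ ℓ) + sumFin N (δ m) + sumFin N (λ k → ⟦ I Q k ⟧ * x k)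
          ≡⟨ cong (_+ sumFin N (λ k → ⟦ I Q k ⟧ * x k)) (sym (sumFin-+ N (δ ℓ) (δ m))) ⟩
        sumFin N (λ k → δ ℓ k + δ m k) + sumFin N (λ k → ⟦ I Q k ⟧ * x k)
          ≡⟨ sym (sumFin-+ N _ _) ⟩
        sumFin N (λ k → δ ℓ k + δ m k + ⟦ I Q k ⟧ * x k)
          ≤⟨ sumFin-mono N pointwise ⟩
        degree Q
          ≡⟨ lines-through Q ⟩
        suc q ∎
        where open ≤-Reasoning

    -- The line joining `Q` to another point of B has `y` at least 2. Both types of line meeting A
    -- have `y` at most 1, so it is external and hence equal to ℓ.
    B⊆external : ∀ {ℓ} → I Q ℓ ≡ true → x ℓ ≡ 0 → ∀ P → B P ≡ true → I P ℓ ≡ true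
    B⊆external {ℓ} Qℓ xℓ P BP with Q ≟ᶠ P
    ... | yes refl = Qℓ
    ... | no  Q≢P with m , Qm , Pm ← join Q P Q≢P =
      subst (λ k → I P k ≡ true) (sym (external-unique Qℓ xℓ Qm xm≡0)) Pm
      where
      2≤y : 2 ≤ y m
      2≤y = countFin-pair N Q≢P (∧-intro BQ Qm) (∧-intro BP Pm)
      xm≡0 : x m ≡ 0
      xm≡0 with line-type m
      ... | inj₁ x≡0              = x≡0
      ... | inj₂ (inj₁ (_ , y≡0)) = contradiction (subst (2 ≤_) y≡0 2≤y) λ ()
      ... | inj₂ (inj₂ (_ , y≡1)) = contradiction (subst (2 ≤_) y≡1 2≤y) λ { (s≤s ()) }

  -- The Baer subplane

  module Baer (ℓ₀ : Line Π) (xℓ₀≡0 : x ℓ₀ ≡ 0) (B⊆ℓ₀ : ∀ P → B P ≡ true → I P ℓ₀ ≡ true) where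
    A-off-ℓ₀ : ∀ P → A P ≡ true → I P ℓ₀ ≡ false
    A-off-ℓ₀ P AP = ¬-not (misses xℓ₀≡0 AP)

    baerPoints : Point Π → Bool
    baerPoints P = A P ∨ (I P ℓ₀ ∧ not (B P))

    baerLines : Line Π → Bool
    baerLines m = does (m ≟ᶠ ℓ₀) ∨ (x m ≡ᵇ p)

    s : Line Π → ℕ
    s = pointsOnIn Π baerPoints

    A⊆baer : ∀ {P} → A P ≡ true → baerPoints P ≡ true
    A⊆baer AP rewrite AP = refl

    -- v_S − v_ℓ₀ = v_A − v_B, without subtraction.
    difference : ∀ P → ⟦ baerPoints P ⟧ + ⟦ B P ⟧ ≡ ⟦ A P ⟧ + ⟦ I P ℓ₀ ⟧
    difference P with A P in AP | B P in BP
    ... | true  | true  = contradiction (trans (sym BP) (A∩B=∅ P AP)) λ ()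
    ... | true  | false rewrite A-off-ℓ₀ P AP = refl
    ... | false | true  rewrite B⊆ℓ₀ P BP = refl
    ... | false | false with I P ℓ₀
    ...   | true  = refl
    ...   | false = refl

    line-difference : ∀ m → s m + y m ≡ x m + pointsOnIn Π (lineSet Π ℓ₀) m
    line-difference m = trans (sym (sumFin-+ N _ _)) (trans (sumFin-cong N pointwise) (sumFin-+ N _ _))
      where
      pointwise : ∀ P → ⟦ baerPoints P ∧ I P m ⟧ + ⟦ B P ∧ I P m ⟧ ≡ ⟦ A P ∧ I P m ⟧ + ⟦ I P ℓ₀ ∧ I P m ⟧
      pointwise P = begin
        ⟦ baerPoints P ∧ I P m ⟧ + ⟦ B P ∧ I P m ⟧ ≡⟨ factor (baerPoints P) (B P) ⟩
        (⟦ baerPoints P ⟧ + ⟦ B P ⟧) * ⟦ I P m ⟧   ≡⟨ cong (_* ⟦ I P m ⟧) (difference P) ⟩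
        (⟦ A P ⟧ + ⟦ I P ℓ₀ ⟧) * ⟦ I P m ⟧         ≡⟨ sym (factor (A P) (I P ℓ₀)) ⟩
        ⟦ A P ∧ I P m ⟧ + ⟦ I P ℓ₀ ∧ I P m ⟧       ∎
        where
        open ≡-Reasoning
        factor : ∀ a b → ⟦ a ∧ I P m ⟧ + ⟦ b ∧ I P m ⟧ ≡ (⟦ a ⟧ + ⟦ b ⟧) * ⟦ I P m ⟧
        factor a b = trans (cong₂ _+_ (⟦∧⟧ a (I P m)) (⟦∧⟧ b (I P m))) (sym (*-distribʳ-+ ⟦ I P m ⟧ ⟦ a ⟧ ⟦ b ⟧))

    -- The 1 is the single intersection point of `m` with `ℓ₀`.
    s+y≡x+1 : ∀ {m} → m ≢ ℓ₀ → s m + y m ≡ x m + 1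
    s+y≡x+1 {m} m≢ℓ₀ = trans (line-difference m) (cong (x m +_) (meet-count (≢-sym m≢ℓ₀)))

    -- All of B lies on `ℓ₀`, which leaves q + 1 - |B| = p + 1 points.
    s-ℓ₀ : s ℓ₀ ≡ suc p
    s-ℓ₀ = +-cancelʳ-≡ ∣B∣ _ _ (begin
      s ℓ₀ + ∣B∣ ≡⟨ cong (s ℓ₀ +_) (sumFin-cong N on-ℓ₀) ⟩
      s ℓ₀ + y ℓ₀ ≡⟨ line-difference ℓ₀ ⟩
      x ℓ₀ + pointsOnIn Π (lineSet Π ℓ₀) ℓ₀ ≡⟨ cong₂ _+_ xℓ₀≡0 (sumFin-cong N (λ P → idem (I P ℓ₀))) ⟩
      countFin N (λ P → I P ℓ₀) ≡⟨ order ℓ₀ ⟩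
      suc q ≡⟨ cong suc (sym ∣B∣+p≡q) ⟩
      suc (∣B∣ + p) ≡⟨ cong suc (+-comm ∣B∣ p) ⟩
      suc p + ∣B∣ ∎)
      where
      open ≡-Reasoning
      idem : ∀ b → ⟦ b ∧ b ⟧ ≡ ⟦ b ⟧
      idem false = refl
      idem true  = refl
      on-ℓ₀ : ∀ P → ⟦ B P ⟧ ≡ ⟦ B P ∧ I P ℓ₀ ⟧
      on-ℓ₀ P with B P in BP
      ... | false = refl
      ... | true rewrite B⊆ℓ₀ P BP = refl

    data IsBaerLine (m : Line Π) : Set where
      is-ℓ₀  : m ≡ ℓ₀ → IsBaerLine m
      secant : m ≢ ℓ₀ → x m ≡ p → y m ≡ 0 → s m ≡ suc p → IsBaerLine m

    isBaerLine : ∀ {m} → baerLines m ≡ true → IsBaerLine m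
    isBaerLine {m} Tm with m ≟ᶠ ℓ₀
    ... | yes m≡ℓ₀ = is-ℓ₀ m≡ℓ₀
    ... | no  m≢ℓ₀ with xm ← ≡ᵇ⇒≡ (x m) p (subst T (sym Tm) _)
                   with secant-or-tangent {m} (subst (1 ≤_) (sym xm) (s≤s z≤n))
    -- A tangent has `x` = 1, and p = 1 would force r = 0.
    ...   | inj₂ (x≡1 , _) = contradiction (subst (2 ≤_) (suc-injective (trans (sym xm) x≡1)) 2≤r) λ ()
    ...   | inj₁ (_ , ym) = secant m≢ℓ₀ xm ym (begin
      s m       ≡⟨ sym (+-identityʳ _) ⟩
      s m + 0   ≡⟨ cong (s m +_) (sym ym) ⟩
      s m + y m ≡⟨ s+y≡x+1 m≢ℓ₀ ⟩
      x m + 1   ≡⟨ trans (+-comm (x m) 1) (cong suc xm) ⟩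
      suc p     ∎)
      where open ≡-Reasoning

    s-baerLine : ∀ {m} → IsBaerLine m → s m ≡ suc p
    s-baerLine (is-ℓ₀ refl)      = s-ℓ₀
    s-baerLine (secant _ _ _ sm) = sm

    2≤s⇒1≤x : ∀ {m} → m ≢ ℓ₀ → 2 ≤ s m → 1 ≤ x m
    2≤s⇒1≤x {m} m≢ℓ₀ 2≤s = s≤s⁻¹ (begin
      2         ≤⟨ 2≤s ⟩
      s m       ≤⟨ m≤m+n (s m) (y m) ⟩
      s m + y m ≡⟨ s+y≡x+1 m≢ℓ₀ ⟩
      x m + 1   ≡⟨ +-comm (x m) 1 ⟩
      suc (x m) ∎)
      where open ≤-Reasoning

    tangent⇒s≡1 : ∀ {m} → m ≢ ℓ₀ → x m ≡ 1 → y m ≡ 1 → s m ≡ 1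
    tangent⇒s≡1 {m} m≢ℓ₀ x≡1 y≡1 = +-cancelʳ-≡ 1 (s m) 1
      (trans (cong (s m +_) (sym y≡1)) (trans (s+y≡x+1 m≢ℓ₀) (cong (_+ 1) x≡1)))

    -- Off `ℓ₀`, two Baer points force a point of A on the line; a tangent would carry only one Baer
    -- point, so the line has `x` = p.
    2≤s⇒baerLine : ∀ {m} → 2 ≤ s m → baerLines m ≡ true
    2≤s⇒baerLine {m} 2≤s with m ≟ᶠ ℓ₀
    ... | yes _    = refl
    ... | no m≢ℓ₀ with secant-or-tangent {m} (2≤s⇒1≤x m≢ℓ₀ 2≤s)
    ...   | inj₁ (xm , _)    = T⇒true (≡⇒≡ᵇ (x m) p xm)
      where
      T⇒true : ∀ {b} → T b → b ≡ true
      T⇒true {true} _ = refl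
    ...   | inj₂ (x≡1 , y≡1) = contradiction 2≤s (<⇒≱ (s≤s (≤-reflexive (tangent⇒s≡1 m≢ℓ₀ x≡1 y≡1))))

    baer-join : ∀ P Q → baerPoints P ≡ true → baerPoints Q ≡ true → P ≢ Q →
      Σ (Line Π) λ m → (baerLines m ≡ true) × (I P m ≡ true) × (I Q m ≡ true)
    baer-join P Q SP SQ P≢Q with m , Pm , Qm ← join P Q P≢Q =
      m , 2≤s⇒baerLine (countFin-pair N P≢Q (∧-intro SP Pm) (∧-intro SQ Qm)) , Pm , Qm

    -- The intersection with `ℓ₀` is not in B because `m` misses B, and the points of `ℓ₀` outside B
    -- are Baer points.
    meet-ℓ₀ : ∀ {m} → m ≢ ℓ₀ → y m ≡ 0 →
      Σ (Point Π) λ P → (baerPoints P ≡ true) × (I P m ≡ true) × (I P ℓ₀ ≡ true)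
    meet-ℓ₀ {m} m≢ℓ₀ ym with P , Pm , Pℓ₀ ← meet m ℓ₀ m≢ℓ₀ = P , SP , Pm , Pℓ₀
      where
      BP : B P ≡ false
      BP = ¬-not (λ BP → misses ym BP Pm)
      SP : baerPoints P ≡ true
      SP rewrite BP | Pℓ₀ with A P
      ... | true  = refl
      ... | false = refl

    -- Each of the p² + 1 lines k through P has |S ∩ m ∩ k| + |B ∩ k| ≤ 1, while these numbers sum
    -- to (p + 1) + (p² − p); so equality holds for every k.
    meet-secants : ∀ {m n P} → m ≢ ℓ₀ → s m ≡ suc p → A P ≡ true → I P m ≡ false → I P n ≡ true → y n ≡ 0 →
      Σ (Point Π) λ R → (baerPoints R ≡ true) × (I R m ≡ true) × (I R n ≡ true)
    meet-secants {m} {n} {P} m≢ℓ₀ sm AP P∉m Pn yn = common-point (≤-reflexive (sym meets))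
      where
      S∩m : Point Π → Bool
      S∩m R = baerPoints R ∧ I R m

      w : Line Π → ℕ
      w = pointsOnIn Π S∩m

      common-point : ∀ {k} → 1 ≤ w k →
        Σ (Point Π) λ R → (baerPoints R ≡ true) × (I R m ≡ true) × (I R k ≡ true)
      common-point 1≤w
        with R , on ← countFin-member N _ 1≤w
        with SRm , Rk ← ∧-elim on
        with SR , Rm ← ∧-elim SRm = R , SR , Rm , Rk

      w+y≤1 : ∀ {k} → I P k ≡ true → w k + y k ≤ 1
      w+y≤1 {k} Pk with secant-or-tangent {k} (A-point⇒1≤x AP Pk)
      -- A secant `k` through `P` differs from `m`, so the two share at most one point.
      ... | inj₁ (_ , y≡0) rewrite y≡0 | +-identityʳ (w k) =
        countFin-≤1 N _ λ R R′ on on′ → meet-unique m k R R′ m≢k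
          (proj₂ (∧-elim {baerPoints R} (proj₁ (∧-elim on)))) (proj₂ (∧-elim on))
          (proj₂ (∧-elim {baerPoints R′} (proj₁ (∧-elim on′)))) (proj₂ (∧-elim on′))
        where
        m≢k : m ≢ k
        m≢k refl = contradiction Pk (not-¬ P∉m)
      ... | inj₂ (x≡1 , y≡1) rewrite y≡1 = ≤-reflexive (cong (_+ 1) (n<1⇒n≡0 (≰⇒> none)))
        where
        k≢ℓ₀ : k ≢ ℓ₀
        k≢ℓ₀ refl = contradiction Pk (not-¬ (A-off-ℓ₀ P AP))
        -- A tangent carries one Baer point, here `P`, and `P` is not on `m`.
        none : ¬ 1 ≤ w k
        none 1≤w with R , SR , Rm , Rk ← common-point 1≤w =
          contradiction (countFin-pair N P≢R (∧-intro (A⊆baer AP) Pk) (∧-intro SR Rk))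
            (<⇒≱ (s≤s (≤-reflexive (tangent⇒s≡1 k≢ℓ₀ x≡1 y≡1))))
          where
          P≢R : P ≢ R
          P≢R refl = contradiction Rm (not-¬ P∉m)

      pointwise : ∀ k → ⟦ I P k ⟧ * w k + ⟦ I P k ⟧ * y k ≤ ⟦ I P k ⟧
      pointwise k with I P k in Pk
      ... | false = z≤n
      ... | true rewrite *-identityˡ (w k) | *-identityˡ (y k) = w+y≤1 Pk

      total : degree P ≤ sumFin N (λ k → ⟦ I P k ⟧ * w k + ⟦ I P k ⟧ * y k)
      total = ≤-reflexive (sym (begin
        sumFin N (λ k → ⟦ I P k ⟧ * w k + ⟦ I P k ⟧ * y k)
          ≡⟨ sumFin-+ N _ _ ⟩
        sumFin N (λ k → ⟦ I P k ⟧ * w k) + sumFin N (λ k → ⟦ I P k ⟧ * y k)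
          ≡⟨ cong₂ _+_ (pencil-sum-∉ P S∩m P∉S∩m) (pencil-sum-∉ P B (A∩B=∅ P AP)) ⟩
        s m + ∣B∣     ≡⟨ cong (_+ ∣B∣) sm ⟩
        suc p + ∣B∣   ≡⟨ cong suc (+-comm p ∣B∣) ⟩
        suc (∣B∣ + p) ≡⟨ cong suc ∣B∣+p≡q ⟩
        suc q   ≡⟨ sym (lines-through P) ⟩
        degree P      ∎))
        where
        open ≡-Reasoning
        P∉S∩m : S∩m P ≡ false
        P∉S∩m = ¬-not (λ on → contradiction (proj₂ (∧-elim {baerPoints P} on)) (not-¬ P∉m))

      meets : w n ≡ 1
      meets = begin
        w n                                   ≡⟨ sym (trans (+-identityʳ _) (*-identityˡ (w n))) ⟩
        1 * w n + 1 * 0                       ≡⟨ cong₂ (λ b v → ⟦ b ⟧ * w n + ⟦ b ⟧ * v) (sym Pn) (sym yn) ⟩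
        ⟦ I P n ⟧ * w n + ⟦ I P n ⟧ * y n     ≡⟨ sumFin-squeeze N pointwise total n ⟩
        ⟦ I P n ⟧                             ≡⟨ cong ⟦_⟧ Pn ⟩
        1                                     ∎
        where open ≡-Reasoning

    baer-meet : ∀ m n → baerLines m ≡ true → baerLines n ≡ true → m ≢ n →
      Σ (Point Π) λ R → (baerPoints R ≡ true) × (I R m ≡ true) × (I R n ≡ true)
    baer-meet m n Tm Tn m≢n with isBaerLine Tm | isBaerLine Tn
    ... | is-ℓ₀ refl | is-ℓ₀ refl = contradiction refl m≢n
    ... | is-ℓ₀ refl | secant n≢ℓ₀ _ yn _ with R , SR , Rn , Rℓ₀ ← meet-ℓ₀ n≢ℓ₀ yn = R , SR , Rℓ₀ , Rn
    ... | secant m≢ℓ₀ _ ym _ | is-ℓ₀ refl = meet-ℓ₀ m≢ℓ₀ ym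
    ... | secant m≢ℓ₀ _ _ sm | secant _ xn yn _
      -- Any point of A on `n` will do: either it is the common point, or it serves as the centre of
      -- the pencil in `meet-secants`.
      with P , on ← countFin-member N _ (subst (1 ≤_) (sym xn) (s≤s z≤n))
      with AP , Pn ← ∧-elim on
      with I P m in Pm
    ...   | true  = P , A⊆baer AP , Pm , Pn
    ...   | false = meet-secants m≢ℓ₀ sm AP Pm Pn yn

    -- Join a point of A to a Baer point on `ℓ₀`. The line differs from `ℓ₀`, which contains no
    -- point of A.
    baer-secant : ∃ λ m → m ≢ ℓ₀ × s m ≡ suc p
    baer-secant = through somePoint-A (countFin-member N _ (≤-trans (s≤s z≤n) (≤-reflexive (sym s-ℓ₀))))
      where
      through : (∃ λ P → A P ≡ true) → (∃ λ R → baerPoints R ∧ I R ℓ₀ ≡ true) → ∃ λ m → m ≢ ℓ₀ × s m ≡ suc p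
      through (P , AP) (R , on) = conclude (baer-join P R (A⊆baer AP) (proj₁ (∧-elim on)) P≢R)
        where
        P≢R : P ≢ R
        P≢R refl = contradiction (proj₂ (∧-elim {baerPoints P} on)) (not-¬ (A-off-ℓ₀ P AP))
        conclude : (∃ λ m → (baerLines m ≡ true) × (I P m ≡ true) × (I R m ≡ true)) → ∃ λ m → m ≢ ℓ₀ × s m ≡ suc p
        conclude (m , Tm , Pm , _) =
          m , (λ { refl → contradiction Pm (not-¬ (A-off-ℓ₀ P AP)) }) , s-baerLine (isBaerLine Tm)

    baer-quadrangle : Quadrangle baerPoints
    baer-quadrangle = from-secant baer-secant
      where
      3≤suc-p : 3 ≤ suc p
      3≤suc-p = s≤s (≤-trans 2≤r (n≤1+n r))
      from-secant : (∃ λ m → m ≢ ℓ₀ × s m ≡ suc p) → Quadrangle baerPoints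
      from-secant (m , m≢ℓ₀ , sm) = quadrangle-from-lines baerPoints m≢ℓ₀
        (≤-trans 3≤suc-p (≤-reflexive (sym sm))) (≤-trans 3≤suc-p (≤-reflexive (sym s-ℓ₀)))

    baerSubplane : IsSubplane Π p baerPoints baerLines
    baerSubplane = baer-join , baer-meet , restrict baer-quadrangle , λ m Tm → s-baerLine (isBaerLine Tm)
      where
      restrict : Quadrangle baerPoints → Σ (Fin 4 → Point Π) λ R → (∀ i → baerPoints (R i) ≡ true) ×
        (∀ i j → i ≢ j → R i ≢ R j) ×
        (∀ i j k → i ≢ j → j ≢ k → i ≢ k → ∀ m → baerLines m ≡ true →
          ¬ ((I (R i) m ≡ true) × (I (R j) m ≡ true) × (I (R k) m ≡ true)))
      restrict (R , inS , distinct , general) =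
        R , inS , distinct , λ i j k i≢j j≢k i≢k m _ → general i j k i≢j j≢k i≢k m

  -- The last component is an identity in ℕ between indicators, not yet reduced mod p, so it can be
  -- read for either sign of the codeword.
  BaerDecomposition : Set
  BaerDecomposition = Σ (Point Π → Bool) λ S → Σ (Line Π → Bool) λ T → IsSubplane Π p S T ×
    Σ (Line Π) λ ℓ → (pointsOnIn Π S ℓ ≡ suc p) × (∀ P → ⟦ S P ⟧ + ⟦ B P ⟧ ≡ ⟦ A P ⟧ + ⟦ I P ℓ ⟧)

  baer-decomposition : BaerDecomposition
  baer-decomposition = at-point somePoint-B
    where
    at-point : (∃ λ Q → B Q ≡ true) → BaerDecomposition
    at-point (Q , BQ) = on-line external
      where
      open AtPointOfB BQ
      on-line : (∃ λ ℓ → I Q ℓ ≡ true × x ℓ ≡ 0) → BaerDecomposition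
      on-line (ℓ , Qℓ , xℓ≡0) = baerPoints , baerLines , baerSubplane , ℓ , s-ℓ₀ , difference
        where open Baer ℓ xℓ≡0 (B⊆external Qℓ xℓ≡0)

-- From the codeword to the two point sets

size-bound : ∀ {p a b ε} → 2 ≤ p → ε ≤ p ∸ 2 → a + b ≡ 2 * p * p ∸ 2 * p + 2 + ε → a ≡ b + p → b + p ≤ p * p
size-bound {p} {a} {b} {ε} 2≤p ε≤ a+b≡ refl = *-cancelˡ-≤ 2 (+-cancelʳ-≤ p _ _ (begin
  -- The weight is 2b + p, and ε ≤ p - 2 makes it at most 2p² - p. Adding 2p to both sides avoids
  -- truncated subtraction.
  2 * (b + p) + p                             ≡⟨ regroup b p ⟩
  b + p + b + 2 * p                           ≡⟨ cong (_+ 2 * p) a+b≡ ⟩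
  2 * p * p ∸ 2 * p + 2 + ε + 2 * p           ≡⟨ regroup′ (2 * p * p ∸ 2 * p) ε (2 * p) ⟩
  2 * p * p ∸ 2 * p + 2 * p + (2 + ε)         ≡⟨ cong (_+ (2 + ε)) (m∸n+n≡m 2p≤2p²) ⟩
  2 * p * p + (2 + ε)                         ≤⟨ +-monoʳ-≤ (2 * p * p) 2+ε≤p ⟩
  2 * p * p + p                               ≡⟨ cong (_+ p) (*-assoc 2 p p) ⟩
  2 * (p * p) + p                             ∎))
  where
  open ≤-Reasoning
  regroup : ∀ b p → 2 * (b + p) + p ≡ b + p + b + 2 * p
  regroup = solve-∀
  regroup′ : ∀ d e u → d + 2 + e + u ≡ d + u + (2 + e)
  regroup′ = solve-∀
  2p≤2p² : 2 * p ≤ 2 * p * p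
  2p≤2p² = ≤-trans (≤-reflexive (sym (*-identityʳ (2 * p)))) (*-monoʳ-≤ (2 * p) (≤-trans (n≤1+n 1) 2≤p))
  2+ε≤p : 2 + ε ≤ p
  2+ε≤p = ≤-trans (+-monoʳ-≤ 2 ε≤) (≤-reflexive (m+[n∸m]≡n 2≤p))

∣a-b∣≡p⇒ : ∀ a b {p} → ∣ a - b ∣ ≡ p → a ≡ b + p ⊎ b ≡ a + p
∣a-b∣≡p⇒ a b refl with ≤-total a b
... | inj₁ a≤b = inj₂ (sym (trans (cong (a +_) (m≤n⇒∣m-n∣≡n∸m a≤b)) (m+[n∸m]≡n a≤b)))
... | inj₂ b≤a = inj₁ (sym (trans (cong (b +_) (m≤n⇒∣n-m∣≡n∸m b≤a)) (m+[n∸m]≡n b≤a)))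

-- Needed because the test of the value 2 + k against itself computes only as far as `k ≡ᵇ k`.
≡ᵇ-refl : ∀ n → (n ≡ᵇ n) ≡ true
≡ᵇ-refl zero    = refl
≡ᵇ-refl (suc n) = ≡ᵇ-refl n

summand : ∀ {n s} {f : Fin n → ℕ} → s ≡ sumFin n f → Fin n → ℕ
summand {f = f} _ = f

-- Here p = 3 + k, so that p ∸ 1 computes to r.
module Codeword (k : ℕ) {q : ℕ} .{{_ : NonZero q}} (q≡p² : q ≡ (3 + k) * (3 + k))
  (Π : ProjectivePlane q) (c : Point Π → Fin (3 + k))
  (entry : ∀ P → (toℕ (c P) ≡ 0) ⊎ (toℕ (c P) ≡ 1) ⊎ (toℕ (c P) ≡ 2 + k))
  where
  open ProjectivePlane Π

  p r N : ℕ
  p = 3 + k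
  r = 2 + k
  N = numPts q

  K : ℕ → Point Π → Bool
  K a P = toℕ (c P) ≡ᵇ a

  K₁∩Kᵣ=∅ : ∀ P → K 1 P ≡ true → K r P ≡ false
  K₁∩Kᵣ=∅ P K₁P with toℕ (c P) | entry P
  ... | _ | inj₁ refl        = refl
  ... | _ | inj₂ (inj₁ refl) = refl
  ... | _ | inj₂ (inj₂ refl) = contradiction K₁P λ ()

  Kᵣ∩K₁=∅ : ∀ P → K r P ≡ true → K 1 P ≡ false
  Kᵣ∩K₁=∅ P KᵣP = ¬-not (λ K₁P → not-¬ (K₁∩Kᵣ=∅ P K₁P) KᵣP)

  weight-split : weight Π c ≡ entryCount Π c 1 + entryCount Π c r
  weight-split = trans (sumFin-cong N pointwise) (sumFin-+ N _ _)
    where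
    -- The summand of weight involves a local function of Defs, so it is obtained by unification.
    pointwise : ∀ P → summand {s = weight Π c} refl P ≡ ⟦ K 1 P ⟧ + ⟦ K r P ⟧
    pointwise P with toℕ (c P) | entry P
    ... | _ | inj₁ refl        = refl
    ... | _ | inj₂ (inj₁ refl) = refl
    ... | _ | inj₂ (inj₂ refl) rewrite ≡ᵇ-refl k = refl

  -- The entry -1 is stored as r = p - 1, so the sum of representatives is exact before any
  -- reduction mod p.
  line-sum : ∀ ℓ → sumFin N (λ P → if I P ℓ then toℕ (c P) else 0)
    ≡ pointsOnIn Π (K 1) ℓ + r * pointsOnIn Π (K r) ℓ
  line-sum ℓ = trans (sumFin-cong N pointwise)
    (trans (sumFin-+ N _ _) (cong (pointsOnIn Π (K 1) ℓ +_) (sumFin-*ˡ N r _)))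
    where
    pointwise : ∀ P → (if I P ℓ then toℕ (c P) else 0) ≡ ⟦ K 1 P ∧ I P ℓ ⟧ + r * ⟦ K r P ∧ I P ℓ ⟧
    pointwise P with I P ℓ | toℕ (c P) | entry P
    ... | true  | _ | inj₁ refl        = sym (*-zeroʳ r)
    ... | false | _ | inj₁ refl        = sym (*-zeroʳ r)
    ... | true  | _ | inj₂ (inj₁ refl) = sym (cong suc (*-zeroʳ r))
    ... | false | _ | inj₂ (inj₁ refl) = sym (*-zeroʳ r)
    ... | true  | _ | inj₂ (inj₂ refl) rewrite ≡ᵇ-refl k = sym (*-identityʳ r)
    ... | false | _ | inj₂ (inj₂ refl) rewrite ≡ᵇ-refl k = sym (*-zeroʳ r)

  dual⇒∣ : InDualCode Π p c → ∀ ℓ → p ∣ pointsOnIn Π (K 1) ℓ + r * pointsOnIn Π (K r) ℓ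
  dual⇒∣ dual ℓ = subst (p ∣_) (line-sum ℓ) (m%n≡0⇒n∣m (sumFin N (λ P → if I P ℓ then toℕ (c P) else 0)) p (dual ℓ))

  -- The two expressions add up to p(x + y). This is the passage from c to -c.
  ∣-swap : ∀ x y → p ∣ x + r * y → p ∣ y + r * x
  ∣-swap x y p∣ = ∣m+n∣m⇒∣n (subst (p ∣_) (sym (total k x y)) (m∣m*n (x + y))) p∣
    where
    total : ∀ k x y → (x + (2 + k) * y) + (y + (2 + k) * x) ≡ (3 + k) * (x + y)
    total = solve-∀

  difference⇒residue : ∀ P s l → ⟦ s ⟧ + ⟦ K r P ⟧ ≡ ⟦ K 1 P ⟧ + ⟦ l ⟧ →
    toℕ (c P) ≡ (⟦ s ⟧ + (p ∸ ⟦ l ⟧)) % p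
  difference⇒residue P s l eq with toℕ (c P) | entry P
  -- For entry 0 the indicators agree, and both 0 + p and 1 + (p - 1) reduce from p to 0.
  difference⇒residue P false false _ | _ | inj₁ refl = sym (n%n≡0 p)
  difference⇒residue P true  true  _ | _ | inj₁ refl = sym (n%n≡0 p)
  difference⇒residue P true  false _ | _ | inj₂ (inj₁ refl) =
    sym (trans ([m+n]%n≡m%n 1 p) (m<n⇒m%n≡m (s≤s {n = r} (s≤s z≤n))))
  -- Here the indicator of `K r` is stuck at `k ≡ᵇ k`, so the equation is rewritten before the cases
  -- on `s` and `l` are decided.
  difference⇒residue P s l eq | _ | inj₂ (inj₂ refl) =
    negative s l (subst (λ b → ⟦ s ⟧ + ⟦ b ⟧ ≡ ⟦ l ⟧) (≡ᵇ-refl k) eq)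
    where
    negative : ∀ s l → ⟦ s ⟧ + 1 ≡ ⟦ l ⟧ → r ≡ (⟦ s ⟧ + (p ∸ ⟦ l ⟧)) % p
    negative false true  _ = sym (m<n⇒m%n≡m (n<1+n r))
    negative true  true  ()
    negative true  false ()

  conclusion : InDualCode Π p c → (ε : ℕ) → ε ≤ p ∸ 2 →
    weight Π c ≡ 2 * p * p ∸ 2 * p + 2 + ε →
    ∣ entryCount Π c 1 - entryCount Π c r ∣ ≡ p →
    Σ (Point Π → Bool) λ S → Σ (Line Π → Bool) λ T → IsSubplane Π p S T ×
      Σ (Line Π) λ ℓ → (pointsOnIn Π S ℓ ≡ suc p) ×
        (IsDifference Π p c S (lineSet Π ℓ) ⊎ IsDifference Π p c (lineSet Π ℓ) S)
  conclusion dual ε ε≤ wt gap = cases (∣a-b∣≡p⇒ (entryCount Π c 1) (entryCount Π c r) gap)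
    where
    2≤p : 2 ≤ p
    2≤p = s≤s (s≤s z≤n)
    a+b : entryCount Π c 1 + entryCount Π c r ≡ 2 * p * p ∸ 2 * p + 2 + ε
    a+b = trans (sym weight-split) wt
    b+a : entryCount Π c r + entryCount Π c 1 ≡ 2 * p * p ∸ 2 * p + 2 + ε
    b+a = trans (+-comm (entryCount Π c r) _) a+b
    cases : entryCount Π c 1 ≡ entryCount Π c r + p ⊎ entryCount Π c r ≡ entryCount Π c 1 + p →
      Σ (Point Π → Bool) λ S → Σ (Line Π → Bool) λ T → IsSubplane Π p S T ×
        Σ (Line Π) λ ℓ → (pointsOnIn Π S ℓ ≡ suc p) ×
          (IsDifference Π p c S (lineSet Π ℓ) ⊎ IsDifference Π p c (lineSet Π ℓ) S)
    cases (inj₁ a≡) = finish baer-decomposition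
      where
      open TwoSets r (s≤s (s≤s z≤n)) q≡p² Π (K 1) (K r) K₁∩Kᵣ=∅ (dual⇒∣ dual) a≡
        (≤-trans (size-bound {p} 2≤p ε≤ a+b a≡) (≤-reflexive (sym q≡p²)))
      finish : BaerDecomposition → _
      finish (S , T , sub , ℓ , sℓ , diff) =
        S , T , sub , ℓ , sℓ , inj₁ (λ P → difference⇒residue P (S P) (I P ℓ) (diff P))
    -- The larger set is now the support of -1, so the two sets exchange roles and the identity
    -- yields v_ℓ - v_S instead.
    cases (inj₂ b≡) = finish baer-decomposition
      where
      open TwoSets r (s≤s (s≤s z≤n)) q≡p² Π (K r) (K 1) Kᵣ∩K₁=∅
        (λ ℓ → ∣-swap (pointsOnIn Π (K 1) ℓ) (pointsOnIn Π (K r) ℓ) (dual⇒∣ dual ℓ)) b≡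
        (≤-trans (size-bound {p} 2≤p ε≤ b+a b≡) (≤-reflexive (sym q≡p²)))
      finish : BaerDecomposition → _
      finish (S , T , sub , ℓ , sℓ , diff) =
        S , T , sub , ℓ , sℓ , inj₂ (λ P → difference⇒residue P (I P ℓ) (S P)
          (trans (+-comm ⟦ I P ℓ ⟧ _) (trans (sym (diff P)) (+-comm ⟦ S P ⟧ _))))

mainTheorem7 : (p : ℕ) .{{_ : NonZero p}} → Prime p → 3 ≤ p →
    (Π : ProjectivePlane (p * p)) → (c : Point Π → Fin p) →
    InDualCode Π p c →
    (ε : ℕ) → 1 ≤ ε → ε ≤ p ∸ 2 →
    weight Π c ≡ 2 * p * p ∸ 2 * p + 2 + ε →
    (∀ P → (toℕ (c P) ≡ 0) ⊎ (toℕ (c P) ≡ 1) ⊎ (toℕ (c P) ≡ p ∸ 1)) →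
    ∣ entryCount Π c 1 - entryCount Π c (p ∸ 1) ∣ ≡ p →
    Σ (Point Π → Bool) λ S → Σ (Line Π → Bool) λ T → IsSubplane Π p S T ×
    Σ (Line Π) λ ℓ → (pointsOnIn Π S ℓ ≡ suc p) ×
    (IsDifference Π p c S (lineSet Π ℓ) ⊎ IsDifference Π p c (lineSet Π ℓ) S)
mainTheorem7 (suc (suc (suc k))) _ _ Π c dual ε _ ε≤ wt entry gap =
  Codeword.conclusion k refl Π c entry dual ε ε≤ wt gap
mainTheorem7 1 _ (s≤s ())
mainTheorem7 2 _ (s≤s (s≤s ()))
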